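{- There is a constant $c>0$ such that for infinitely many positive integers $g$, there exists a graph embeddable on a surface of Euler genus $g$ that has no $\left(2,\lfloor c\sqrt{g}\rfloor,\lfloor c\sqrt{g}\rfloor\right)$-coloring.
   Context: All graphs are finite and simple (no loops, no multiple edges). For integers $d_1,\ldots,d_k$, a $(d_1,\ldots,d_k)$-coloring of a graph $G$ is an assignment to each vertex of a color from $\{1,\ldots,k\}$ such that for each $i$, every vertex colored $i$ has at most $d_i$ neighbors colored $i$. A surface is a non-null compact connected 2-manifold without boundary. The Euler genus of a surface is $2h$ if it is the orientable surface obtained from the sphere by adding $h\ge 0$ handles, and $k$ if it is the non-orientable surface obtained from the sphere by adding $k\ge 1$ cross-caps. -}

module Defs where

open import Data.Fin using (Fin)
import Data.Fin as Fin
import Data.Integer as ℤ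
open import Data.List using (List; []; _∷_; _++_; [_]; map; concatMap; reverse; zip; take; drop; concat; filter; length; allFin)
open import Data.List.Membership.Propositional using (_∈_)
open import Data.List.Relation.Binary.Permutation.Propositional using (_↭_)
open import Data.List.Relation.Unary.All using (All)
open import Data.Nat using (ℕ; zero; suc; _+_; _*_; _≤_; NonZero)
import Data.Nat as ℕ
open import Data.Product using (Σ; ∃; ∃-syntax; _×_; _,_)
import Data.Rational.Unnormalised as ℚᵘ
open import Data.Vec using (Vec; lookup)
open import Function.Definitions using (Injective)
open import Level using (0ℓ)
open import Relation.Binary.Core using (Rel)
open import Relation.Binary.Construct.Closure.Equivalence using (EqClosure)
open import Relation.Binary.Definitions using (Decidable; Symmetric; Irreflexive)
open import Relation.Binary.PropositionalEquality using (_≡_; _≢_)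
open import Relation.Nullary using (yes; no)
open import Relation.Nullary.Decidable using (_×-dec_)

record Graph : Set₁ where
  field
    order  : ℕ
    Adj    : Rel (Fin order) 0ℓ
    adj?   : Decidable Adj
    sym    : Symmetric Adj
    irrefl : Irreflexive _≡_ Adj

  Vertex : Set
  Vertex = Fin order

module _ (G : Graph) where
  open Graph G

  sameColourNeighbours : ∀ {k} → (Vertex → Fin k) → Vertex → List Vertex
  sameColourNeighbours f v =
    filter (λ u → adj? v u ×-dec (f u Fin.≟ f v)) (allFin order)

  -- The (d₁,…,d_k)-colorings of G, for d = (d₁,…,d_k).
  DefectiveColouring : ∀ {k} → Vec ℕ k → Set
  DefectiveColouring {k} d = Σ (Vertex → Fin k) λ f →
    ∀ v → length (sameColourNeighbours f v) ≤ lookup d (f v)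

-- Surfaces are presented combinatorially, by polygons with sides glued in
-- pairs.  The 1-cells are named by natural numbers; n ⁺ and n ⁻ are the two
-- orientations of the 1-cell n.

infix 10 _⁺ _⁻

data Dart : Set where
  _⁺ _⁻ : ℕ → Dart

label : Dart → ℕ
label (n ⁺) = n
label (n ⁻) = n

inv : Dart → Dart
inv (n ⁺) = n ⁻
inv (n ⁻) = n ⁺

-- The boundary of a 2-cell, read cyclically: the end of each dart is the
-- origin of the next one.
Polygon : Set
Polygon = List Dart

CellComplex : Set
CellComplex = List Polygon

invPolygon : Polygon → Polygon
invPolygon w = map inv (reverse w)

Occurs : Dart → CellComplex → Set
Occurs d P = label d ∈ map label (concat P)

Fresh : ℕ → CellComplex → Set
Fresh n = All (All (λ d → label d ≢ n))

-- A renaming of the 1-cells, possibly changing their reference orientation.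
rename : (ℕ → Dart) → Dart → Dart
rename f (n ⁺) = f n
rename f (n ⁻) = inv (f n)

-- Subdivision of the 1-cell a into the path a b.
subdivideDart : ℕ → ℕ → Dart → List Dart
subdivideDart a b (n ⁺) with n ℕ.≟ a
... | yes _ = n ⁺ ∷ b ⁺ ∷ []
... | no  _ = n ⁺ ∷ []
subdivideDart a b (n ⁻) with n ℕ.≟ a
... | yes _ = b ⁻ ∷ n ⁻ ∷ []
... | no  _ = n ⁻ ∷ []

-- Changes of presentation (order of the polygons, starting point and direction
-- in which each is read, names of the 1-cells) and the elementary subdivisions
-- of 1-cells and 2-cells.
infix 4 _⟶_ _≅_

data _⟶_ : Rel CellComplex 0ℓ where
  permute : ∀ {P Q} → P ↭ Q → P ⟶ Q
  rotate  : ∀ u v {P} → (u ++ v) ∷ P ⟶ (v ++ u) ∷ P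
  flip    : ∀ w {P} → w ∷ P ⟶ invPolygon w ∷ P
  relabel : ∀ (f : ℕ → Dart) {P} → Injective _≡_ _≡_ (λ n → label (f n)) →
            P ⟶ map (map (rename f)) P
  subdivide₁ : ∀ a b {P} → Fresh b P →
               P ⟶ map (concatMap (subdivideDart a b)) P
  subdivide₂ : ∀ c u v {P} → Fresh c ((u ++ v) ∷ P) →
               (u ++ v) ∷ P ⟶ (u ++ [ c ⁺ ]) ∷ (c ⁻ ∷ v) ∷ P

-- Combinatorial (PL) homeomorphism: having a common refinement up to
-- elementary subdivisions and their inverses.
_≅_ : Rel CellComplex 0ℓ
_≅_ = EqClosure _⟶_

-- Inserting a b a⁻¹ b⁻¹ at a corner of a polygon removes an open disc at that
-- corner and glues in a handle (a torus minus an open disc).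
handles : ℕ → Polygon
handles zero    = []
handles (suc h) = a ⁺ ∷ b ⁺ ∷ a ⁻ ∷ b ⁻ ∷ handles h
  where
  a = 1 + 2 * h
  b = 2 + 2 * h

-- Likewise, inserting a a glues in a cross-cap (a projective plane minus an
-- open disc, that is, a Möbius band).
crossCaps : ℕ → Polygon
crossCaps zero    = []
crossCaps (suc k) = suc k ⁺ ∷ suc k ⁺ ∷ crossCaps k

-- The sphere is the bigon s s⁻¹, here with s = 0.
sphereWithHandles : ℕ → CellComplex
sphereWithHandles h = [ 0 ⁺ ∷ 0 ⁻ ∷ handles h ]

sphereWithCrossCaps : ℕ → CellComplex
sphereWithCrossCaps k = [ 0 ⁺ ∷ 0 ⁻ ∷ crossCaps k ]

-- "P is a cell decomposition of a surface of Euler genus g".  That each 1-cell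
-- of P is used exactly twice and that P is connected need not be required:
-- both hold for the two models and are preserved by _≅_.
data HasEulerGenus (P : CellComplex) : ℕ → Set where
  orientable    : ∀ h → P ≅ sphereWithHandles h → HasEulerGenus P (2 * h)
  nonOrientable : ∀ k .{{_ : NonZero k}} → P ≅ sphereWithCrossCaps k →
                  HasEulerGenus P k

-- Pairs of cyclically consecutive darts.
corners : Polygon → List (Dart × Dart)
corners w = zip w (drop 1 w ++ take 1 w)

-- At a corner (d , e), the end of d (the origin of inv d) is the origin of e.
CornerIdentification : CellComplex → Rel Dart 0ℓ
CornerIdentification P x y = ∃[ w ] (w ∈ P × (inv x , y) ∈ corners w)

-- The 0-cells of P are the classes of darts with the same origin.
SameOrigin : CellComplex → Rel Dart 0ℓ
SameOrigin P = EqClosure (CornerIdentification P)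

-- G drawn in the 1-skeleton of P.  Distinct edges of G get distinct 1-cells
-- because G is simple and `at` is injective on 0-cells.
record Drawing (G : Graph) (P : CellComplex) : Set where
  open Graph G
  field
    at       : Vertex → Dart
    occurs   : ∀ v → Occurs (at v) P
    distinct : ∀ {u v} → SameOrigin P (at u) (at v) → u ≡ v
    edge     : ∀ {u v} → Adj u v → ∃[ d ]
               (Occurs d P × SameOrigin P d (at u) × SameOrigin P (inv d) (at v))

-- Any graph embedded in a surface extends, by adding vertices and edges, to
-- the 1-skeleton of a cell decomposition of that surface.
EmbeddableOnEulerGenus : Graph → ℕ → Set
EmbeddableOnEulerGenus G g = ∃[ P ] (HasEulerGenus P g × Drawing G P)

fromℕ : ℕ → ℚᵘ.ℚᵘ
fromℕ n = (ℤ.+ n) ℚᵘ./ 1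

-- m = ⌊c√g⌋ for c ≥ 0: squaring m ≤ c√g < m + 1.
_IsFloorOf_√_ : ℕ → ℚᵘ.ℚᵘ → ℕ → Set
m IsFloorOf c √ g =
  (fromℕ m ℚᵘ.* fromℕ m ℚᵘ.≤ c ℚᵘ.* c ℚᵘ.* fromℕ g) ×
  (c ℚᵘ.* c ℚᵘ.* fromℕ g ℚᵘ.< fromℕ (suc m) ℚᵘ.* fromℕ (suc m))

{-# OPTIONS --safe #-}
module Submission where

-- A (2,m,m)-coloring of the complete graph Kₙ has colour classes of at most 3,
-- m+1 and m+1 vertices, so there is none when n > 2m+5; and Kₙ embeds in a
-- surface of Euler genus n(n−1).  For the embedding, put the n vertices on a
-- path drawn in the sphere, whose complement is a single polygon.  An edge E
-- from one corner of the polygon to another, followed by a loop F at its far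
-- end, is added by inserting E F E⁻¹ at the first corner and F at the second:
-- the complement stays one polygon, no part of it is reversed, and the genus
-- grows by two cross-caps.  For n = 4m+2 the genus g = n(n−1) satisfies
-- m = ⌊√g/4⌋.

open import Defs
open import Data.Fin using (Fin; zero; suc; toℕ)
import Data.Fin as Fin
open import Data.Fin.Properties using (toℕ<n; toℕ-injective)
import Data.Integer as ℤ
import Data.Integer.Properties as ℤ
open import Data.List using (List; []; _∷_; _++_; [_]; map; concat; concatMap; reverse; zip; length; filter; allFin; upTo)
open import Data.List.Membership.Propositional using (_∈_)
open import Data.List.Membership.Propositional.Properties using (∈-++⁺ˡ; ∈-++⁺ʳ; ∈-map⁺; ∈-upTo⁺; ∈-filter⁻)
open import Data.List.Properties using (++-assoc; ++-identityʳ; ++-monoid; concatMap-++; length-++; length-map; length-tabulate; length-upTo; map-++; map-∘; map-id-local; reverse-++; reverse-involutive; reverse-map)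
open import Data.List.Relation.Binary.Permutation.Propositional using (↭-refl; swap)
open import Data.List.Relation.Binary.Sublist.Propositional as Sublist using (_⊆_; _∷_; _∷ʳ_; ⊆-trans; ⊆-refl; from∈)
import Data.List.Relation.Binary.Sublist.Propositional.Properties as Sublist
open import Data.List.Relation.Unary.All as All using (All; []; _∷_)
open import Data.List.Relation.Unary.All.Properties as All using (++⁺; ++⁻; ++⁻ʳ; all-upTo)
open import Data.List.Relation.Unary.AllPairs using ([]; _∷_)
open import Data.List.Relation.Unary.Any using (here; there)
open import Data.List.Relation.Unary.Unique.Propositional using (Unique)
open import Data.List.Relation.Unary.Unique.Propositional.Properties using (allFin⁺)
open import Data.Nat using (ℕ; zero; suc; _+_; _*_; _≤_; _<_; z≤n; s≤s; NonZero; _≟_)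
open import Data.Nat.Properties hiding (_≟_)
open import Data.Nat.Tactic.RingSolver using (solve-∀)
open import Data.Product using (∃-syntax; _×_; _,_; proj₁; proj₂)
open import Data.Rational.Unnormalised using (ℚᵘ; Positive; mkℚᵘ; *≤*; *<*)
open import Data.Sum using (inj₁; inj₂)
open import Data.Vec using (Vec; _∷_; []; lookup)
open import Function.Base using (_on_)
open import Function.Definitions using (Injective)
open import Level using (0ℓ)
open import Relation.Binary.Bundles using (Setoid)
import Relation.Binary.Construct.Closure.Equivalence as Eq
import Relation.Binary.Construct.On as On
open import Relation.Binary.Core using (Rel; _⇒_)
open import Relation.Binary.Definitions using (tri<; tri≈; tri>)
open import Relation.Binary.PropositionalEquality using (_≡_; _≢_; refl; sym; trans; cong; cong₂; subst; subst₂; ≢-sym; isEquivalence; module ≡-Reasoning)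
import Relation.Binary.Reasoning.Setoid as SetoidReasoning
open import Relation.Binary.Structures using (IsEquivalence)
open import Relation.Nullary using (¬_; yes; no; contradiction)
open import Relation.Nullary.Decidable using (¬?; _×-dec_)
open import Tactic.MonoidSolver using (solve)

-- Cut and paste

inv-involutive : ∀ d → inv (inv d) ≡ d
inv-involutive (n ⁺) = refl
inv-involutive (n ⁻) = refl

label-inv : ∀ d → label (inv d) ≡ label d
label-inv (n ⁺) = refl
label-inv (n ⁻) = refl

invPolygon-++ : ∀ u v → invPolygon (u ++ v) ≡ invPolygon v ++ invPolygon u
invPolygon-++ u v = trans (cong (map inv) (reverse-++ u v)) (map-++ inv (reverse v) (reverse u))

invPolygon-∷ : ∀ d w → invPolygon (d ∷ w) ≡ invPolygon w ++ [ inv d ]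
invPolygon-∷ d w = invPolygon-++ [ d ] w

invPolygon-involutive : ∀ w → invPolygon (invPolygon w) ≡ w
invPolygon-involutive w = begin
  map inv (reverse (map inv (reverse w))) ≡⟨ cong (map inv) (reverse-map inv (reverse w)) ⟨
  map inv (map inv (reverse (reverse w))) ≡⟨ map-∘ (reverse (reverse w)) ⟨
  map (λ d → inv (inv d)) (reverse (reverse w)) ≡⟨ map-id-local (All.universal inv-involutive _) ⟩
  reverse (reverse w) ≡⟨ reverse-involutive w ⟩
  w ∎
  where open ≡-Reasoning

FreshIn : ℕ → Polygon → Set
FreshIn n = All (λ d → label d ≢ n)

FreshIn-invPolygon : ∀ {n} w → FreshIn n w → FreshIn n (invPolygon w)
FreshIn-invPolygon []      []         = []
FreshIn-invPolygon (d ∷ w) (d≢n ∷ w#n) =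
  subst (FreshIn _) (sym (invPolygon-∷ d w))
    (++⁺ (FreshIn-invPolygon w w#n) ((λ eq → d≢n (trans (sym (label-inv d)) eq)) ∷ []))

module ≅ = Setoid (Eq.setoid _⟶_)
module ≅-Reasoning = SetoidReasoning (Eq.setoid _⟶_)

step : ∀ {P Q} → P ⟶ Q → P ≅ Q
step = Eq.return

unstep : ∀ {P Q} → P ⟶ Q → Q ≅ P
unstep s = ≅.sym (step s)

-- Cutting along the new 1-cell X and regluing along E.
crosscapʳ : ∀ {E X} b R → X ≢ E → FreshIn E b → FreshIn E R → FreshIn X b → FreshIn X R →
  [ E ⁺ ∷ invPolygon b ++ E ⁺ ∷ R ] ≅ [ b ++ X ⁻ ∷ X ⁻ ∷ R ]
crosscapʳ {E} {X} b R X≢E b#E R#E b#X R#X = begin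
  [ E ⁺ ∷ b⁻¹ ++ E ⁺ ∷ R ]                              ≈⟨ step (rotate [ E ⁺ ] (b⁻¹ ++ E ⁺ ∷ R)) ⟩
  [ (b⁻¹ ++ E ⁺ ∷ R) ++ [ E ⁺ ] ]                       ≡⟨ cong [_] (regroup b⁻¹ [ E ⁺ ] R [ E ⁺ ]) ⟩
  [ (b⁻¹ ++ [ E ⁺ ]) ++ (R ++ [ E ⁺ ]) ]                ≈⟨ step (subdivide₂ X (b⁻¹ ++ [ E ⁺ ]) (R ++ [ E ⁺ ]) cutFresh) ⟩
  ((b⁻¹ ++ [ E ⁺ ]) ++ [ X ⁺ ]) ∷ (X ⁻ ∷ R ++ [ E ⁺ ]) ∷ [] ≈⟨ step (flip _) ⟩
  invPolygon ((b⁻¹ ++ [ E ⁺ ]) ++ [ X ⁺ ]) ∷ (X ⁻ ∷ R ++ [ E ⁺ ]) ∷ []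
    ≡⟨ cong (_∷ (X ⁻ ∷ R ++ [ E ⁺ ]) ∷ []) flipped ⟩
  (X ⁻ ∷ E ⁻ ∷ b) ∷ (X ⁻ ∷ R ++ [ E ⁺ ]) ∷ []           ≈⟨ step (rotate [ X ⁻ ] (E ⁻ ∷ b)) ⟩
  (E ⁻ ∷ b ++ [ X ⁻ ]) ∷ (X ⁻ ∷ R ++ [ E ⁺ ]) ∷ []      ≈⟨ step (permute (swap _ _ ↭-refl)) ⟩
  (X ⁻ ∷ R ++ [ E ⁺ ]) ∷ (E ⁻ ∷ b ++ [ X ⁻ ]) ∷ []      ≈⟨ unstep (subdivide₂ E (X ⁻ ∷ R) (b ++ [ X ⁻ ]) glueFresh) ⟩
  [ (X ⁻ ∷ R) ++ (b ++ [ X ⁻ ]) ]                       ≈⟨ step (rotate (X ⁻ ∷ R) (b ++ [ X ⁻ ])) ⟩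
  [ (b ++ [ X ⁻ ]) ++ X ⁻ ∷ R ]                         ≡⟨ cong [_] (++-assoc b [ X ⁻ ] (X ⁻ ∷ R)) ⟩
  [ b ++ X ⁻ ∷ X ⁻ ∷ R ]                                ∎
  where
  open ≅-Reasoning
  b⁻¹ = invPolygon b
  E≢X = λ (eq : E ≡ X) → X≢E (sym eq)
  regroup : (p q r s : Polygon) → (p ++ (q ++ r)) ++ s ≡ (p ++ q) ++ (r ++ s)
  regroup p q r s = solve (++-monoid Dart)
  flipped : invPolygon ((b⁻¹ ++ [ E ⁺ ]) ++ [ X ⁺ ]) ≡ X ⁻ ∷ E ⁻ ∷ b
  flipped = trans (invPolygon-++ (b⁻¹ ++ [ E ⁺ ]) [ X ⁺ ])
    (cong (X ⁻ ∷_) (trans (invPolygon-++ b⁻¹ [ E ⁺ ]) (cong (E ⁻ ∷_) (invPolygon-involutive b))))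
  cutFresh : Fresh X [ (b⁻¹ ++ [ E ⁺ ]) ++ (R ++ [ E ⁺ ]) ]
  cutFresh = ++⁺ (++⁺ (FreshIn-invPolygon b b#X) (E≢X ∷ [])) (++⁺ R#X (E≢X ∷ [])) ∷ []
  glueFresh : Fresh E [ (X ⁻ ∷ R) ++ (b ++ [ X ⁻ ]) ]
  glueFresh = (X≢E ∷ ++⁺ R#E (++⁺ b#E (X≢E ∷ []))) ∷ []

-- The cut joins the origins of the two occurrences of `E`, where `crosscapʳ` joins their ends. The
-- pair of `X`s then lands before `b` instead of behind it, and `moveCrosscap` compares the two
-- outcomes.
crosscapˡ : ∀ {E X} b R → X ≢ E → FreshIn E b → FreshIn E R → FreshIn X b → FreshIn X R →
  [ E ⁺ ∷ invPolygon b ++ E ⁺ ∷ R ] ≅ [ X ⁻ ∷ X ⁻ ∷ b ++ R ]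
crosscapˡ {E} {X} b R X≢E b#E R#E b#X R#X = begin
  [ (E ⁺ ∷ b⁻¹) ++ E ⁺ ∷ R ]                            ≈⟨ step (subdivide₂ X (E ⁺ ∷ b⁻¹) (E ⁺ ∷ R) cutFresh) ⟩
  ((E ⁺ ∷ b⁻¹) ++ [ X ⁺ ]) ∷ (X ⁻ ∷ E ⁺ ∷ R) ∷ []       ≈⟨ step (flip _) ⟩
  invPolygon ((E ⁺ ∷ b⁻¹) ++ [ X ⁺ ]) ∷ (X ⁻ ∷ E ⁺ ∷ R) ∷ []
    ≡⟨ cong (_∷ (X ⁻ ∷ E ⁺ ∷ R) ∷ []) flipped ⟩
  ((X ⁻ ∷ b) ++ [ E ⁻ ]) ∷ (X ⁻ ∷ E ⁺ ∷ R) ∷ []         ≈⟨ step (rotate (X ⁻ ∷ b) [ E ⁻ ]) ⟩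
  (E ⁻ ∷ X ⁻ ∷ b) ∷ (X ⁻ ∷ E ⁺ ∷ R) ∷ []                ≈⟨ step (permute (swap _ _ ↭-refl)) ⟩
  (X ⁻ ∷ E ⁺ ∷ R) ∷ (E ⁻ ∷ X ⁻ ∷ b) ∷ []                ≈⟨ step (rotate (X ⁻ ∷ E ⁺ ∷ []) R) ⟩
  (R ++ X ⁻ ∷ E ⁺ ∷ []) ∷ (E ⁻ ∷ X ⁻ ∷ b) ∷ []
    ≡⟨ cong (_∷ (E ⁻ ∷ X ⁻ ∷ b) ∷ []) (++-assoc R [ X ⁻ ] [ E ⁺ ]) ⟨
  ((R ++ [ X ⁻ ]) ++ [ E ⁺ ]) ∷ (E ⁻ ∷ X ⁻ ∷ b) ∷ []    ≈⟨ unstep (subdivide₂ E (R ++ [ X ⁻ ]) (X ⁻ ∷ b) glueFresh) ⟩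
  [ (R ++ [ X ⁻ ]) ++ X ⁻ ∷ b ]                         ≡⟨ cong [_] (++-assoc R [ X ⁻ ] (X ⁻ ∷ b)) ⟩
  [ R ++ X ⁻ ∷ X ⁻ ∷ b ]                                ≈⟨ step (rotate R (X ⁻ ∷ X ⁻ ∷ b)) ⟩
  [ X ⁻ ∷ X ⁻ ∷ b ++ R ]                                ∎
  where
  open ≅-Reasoning
  b⁻¹ = invPolygon b
  E≢X = λ (eq : E ≡ X) → X≢E (sym eq)
  flipped : invPolygon ((E ⁺ ∷ b⁻¹) ++ [ X ⁺ ]) ≡ (X ⁻ ∷ b) ++ [ E ⁻ ]
  flipped = trans (invPolygon-++ (E ⁺ ∷ b⁻¹) [ X ⁺ ])
    (cong (X ⁻ ∷_) (trans (invPolygon-∷ (E ⁺) b⁻¹) (cong (_++ [ E ⁻ ]) (invPolygon-involutive b))))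
  cutFresh : Fresh X [ (E ⁺ ∷ b⁻¹) ++ E ⁺ ∷ R ]
  cutFresh = (E≢X ∷ ++⁺ (FreshIn-invPolygon b b#X) (E≢X ∷ R#X)) ∷ []
  glueFresh : Fresh E [ (R ++ [ X ⁻ ]) ++ X ⁻ ∷ b ]
  glueFresh = ++⁺ (++⁺ R#E (X≢E ∷ [])) (X≢E ∷ b#E) ∷ []

-- Both sides are E c⁻¹ E R A, for an auxiliary 1-cell E.
moveCrosscap : ∀ {E X} A c R → X ≢ E → FreshIn E A → FreshIn E c → FreshIn E R →
  FreshIn X A → FreshIn X c → FreshIn X R →
  [ A ++ X ⁻ ∷ X ⁻ ∷ c ++ R ] ≅ [ A ++ c ++ X ⁻ ∷ X ⁻ ∷ R ]
moveCrosscap {E} {X} A c R X≢E A#E c#E R#E A#X c#X R#X = begin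
  [ A ++ xx ++ c ++ R ]        ≈⟨ step (rotate A (xx ++ c ++ R)) ⟩
  [ (xx ++ c ++ R) ++ A ]      ≡⟨ cong [_] (regroup xx c R A) ⟩
  [ xx ++ c ++ R ++ A ]        ≈⟨ crosscapˡ c (R ++ A) X≢E c#E (++⁺ R#E A#E) c#X (++⁺ R#X A#X) ⟨
  [ E ⁺ ∷ invPolygon c ++ E ⁺ ∷ R ++ A ] ≈⟨ crosscapʳ c (R ++ A) X≢E c#E (++⁺ R#E A#E) c#X (++⁺ R#X A#X) ⟩
  [ c ++ xx ++ R ++ A ]        ≡⟨ cong [_] (regroup c xx R A) ⟨
  [ (c ++ xx ++ R) ++ A ]      ≈⟨ step (rotate (c ++ xx ++ R) A) ⟩
  [ A ++ c ++ xx ++ R ]        ∎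
  where
  open ≅-Reasoning
  xx = X ⁻ ∷ X ⁻ ∷ []
  regroup : (p q r s : Polygon) → (p ++ (q ++ r)) ++ s ≡ p ++ (q ++ (r ++ s))
  regroup p q r s = solve (++-monoid Dart)

-- Read from its first `F`, the polygon begins `F (E⁻ D) F`, so `crosscapʳ` trades `F` for `X` and
-- reverses `E⁻ D`. Now `E` occurs twice in the same direction around the reversed `D`; a second
-- `crosscapʳ` trades `E` for `Y` and restores `D`. Both cross-caps are then moved past `B` to join
-- those in `T`.
tieToCrosscaps : ∀ {E F X Y} A D B T →
  F ≢ E → X ≢ E → X ≢ F → Y ≢ E → Y ≢ X →
  FreshIn E (A ++ D ++ B ++ T) → FreshIn F (A ++ D ++ B ++ T) →
  FreshIn X (A ++ D ++ B ++ T) → FreshIn Y (A ++ D ++ B ++ T) →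
  [ A ++ E ⁺ ∷ F ⁺ ∷ E ⁻ ∷ D ++ F ⁺ ∷ B ++ T ] ≅
  [ A ++ D ++ B ++ Y ⁻ ∷ Y ⁻ ∷ X ⁻ ∷ X ⁻ ∷ T ]
tieToCrosscaps {E} {F} {X} {Y} A D B T F≢E X≢E X≢F Y≢E Y≢X E# F# X# Y# =
  let A#E , D#E , B#E , T#E = parts E#
      A#F , D#F , B#F , T#F = parts F#
      A#X , D#X , B#X , T#X = parts X#
      A#Y , D#Y , B#Y , T#Y = parts Y#
      E≢F = λ eq → F≢E (sym eq)
      E≢X = λ eq → X≢E (sym eq)
      E≢Y = λ eq → Y≢E (sym eq)
      X≢Y = λ eq → Y≢X (sym eq)
  in begin
  [ A ++ E ⁺ ∷ F ⁺ ∷ (E ⁻ ∷ D) ++ F ⁺ ∷ B ++ T ]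
    ≡⟨ cong [_] (++-assoc A [ E ⁺ ] _) ⟨
  [ (A ++ [ E ⁺ ]) ++ F ⁺ ∷ (E ⁻ ∷ D) ++ F ⁺ ∷ B ++ T ]
    ≈⟨ step (rotate (A ++ [ E ⁺ ]) _) ⟩
  [ (F ⁺ ∷ (E ⁻ ∷ D) ++ F ⁺ ∷ B ++ T) ++ (A ++ [ E ⁺ ]) ]
    ≡⟨ cong [_] (regroup₁ (F ⁺ ∷ E ⁻ ∷ D) (F ⁺ ∷ B) T A [ E ⁺ ]) ⟩
  [ F ⁺ ∷ (E ⁻ ∷ D) ++ F ⁺ ∷ B ++ T ++ A ++ [ E ⁺ ] ]
    ≡⟨ cong (λ w → [ F ⁺ ∷ w ++ F ⁺ ∷ B ++ T ++ A ++ [ E ⁺ ] ]) inverse ⟨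
  [ F ⁺ ∷ invPolygon (invPolygon D ++ [ E ⁺ ]) ++ F ⁺ ∷ B ++ T ++ A ++ [ E ⁺ ] ]
    ≈⟨ crosscapʳ (invPolygon D ++ [ E ⁺ ]) (B ++ T ++ A ++ [ E ⁺ ]) X≢F
         (++⁺ (FreshIn-invPolygon D D#F) (E≢F ∷ [])) (++⁺ B#F (++⁺ T#F (++⁺ A#F (E≢F ∷ []))))
         (++⁺ (FreshIn-invPolygon D D#X) (E≢X ∷ [])) (++⁺ B#X (++⁺ T#X (++⁺ A#X (E≢X ∷ [])))) ⟩
  [ (invPolygon D ++ [ E ⁺ ]) ++ xx ++ B ++ T ++ A ++ [ E ⁺ ] ]
    ≡⟨ cong [_] (regroup₂ (invPolygon D) [ E ⁺ ] (xx ++ B) T A [ E ⁺ ]) ⟩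
  [ (invPolygon D ++ E ⁺ ∷ xx ++ B ++ T ++ A) ++ [ E ⁺ ] ]
    ≈⟨ step (rotate (invPolygon D ++ E ⁺ ∷ xx ++ B ++ T ++ A) [ E ⁺ ]) ⟩
  [ E ⁺ ∷ invPolygon D ++ E ⁺ ∷ xx ++ B ++ T ++ A ]
    ≈⟨ crosscapʳ D (xx ++ B ++ T ++ A) Y≢E
         D#E (X≢E ∷ X≢E ∷ ++⁺ B#E (++⁺ T#E A#E)) D#Y (X≢Y ∷ X≢Y ∷ ++⁺ B#Y (++⁺ T#Y A#Y)) ⟩
  [ D ++ yy ++ xx ++ B ++ T ++ A ]
    ≡⟨ cong [_] (regroup₃ D (yy ++ xx ++ B) T A) ⟩
  [ (D ++ yy ++ xx ++ B ++ T) ++ A ]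
    ≈⟨ step (rotate (D ++ yy ++ xx ++ B ++ T) A) ⟩
  [ A ++ D ++ yy ++ xx ++ B ++ T ]
    ≡⟨ cong [_] (regroup₃ A D yy (xx ++ B ++ T)) ⟩
  [ (A ++ D ++ yy) ++ xx ++ B ++ T ]
    -- `E` has disappeared from the polygon and is free to serve as the auxiliary 1-cell.
    ≈⟨ moveCrosscap (A ++ D ++ yy) B T X≢E
         (++⁺ A#E (++⁺ D#E (Y≢E ∷ Y≢E ∷ []))) B#E T#E (++⁺ A#X (++⁺ D#X (Y≢X ∷ Y≢X ∷ []))) B#X T#X ⟩
  [ (A ++ D ++ yy) ++ B ++ xx ++ T ]
    ≡⟨ cong [_] (regroup₄ A D yy (B ++ xx ++ T)) ⟩
  [ (A ++ D) ++ yy ++ B ++ xx ++ T ]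
    ≈⟨ moveCrosscap (A ++ D) B (xx ++ T) Y≢E
         (++⁺ A#E D#E) B#E (X≢E ∷ X≢E ∷ T#E) (++⁺ A#Y D#Y) B#Y (X≢Y ∷ X≢Y ∷ T#Y) ⟩
  [ (A ++ D) ++ B ++ yy ++ xx ++ T ]
    ≡⟨ cong [_] (++-assoc A D _) ⟩
  [ A ++ D ++ B ++ yy ++ xx ++ T ] ∎
  where
  open ≅-Reasoning
  xx = X ⁻ ∷ X ⁻ ∷ []
  yy = Y ⁻ ∷ Y ⁻ ∷ []
  parts : ∀ {n} → FreshIn n (A ++ D ++ B ++ T) →
    FreshIn n A × FreshIn n D × FreshIn n B × FreshIn n T
  parts ADBT# =
    let A# , DBT# = ++⁻ A ADBT#
        D# , BT#  = ++⁻ D DBT#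
        B# , T#   = ++⁻ B BT#
    in A# , D# , B# , T#
  inverse : invPolygon (invPolygon D ++ [ E ⁺ ]) ≡ E ⁻ ∷ D
  inverse = trans (invPolygon-++ (invPolygon D) [ E ⁺ ]) (cong (E ⁻ ∷_) (invPolygon-involutive D))
  regroup₁ : (p q r s t : Polygon) → (p ++ (q ++ r)) ++ (s ++ t) ≡ p ++ (q ++ (r ++ (s ++ t)))
  regroup₁ p q r s t = solve (++-monoid Dart)
  regroup₂ : (p q r s t u : Polygon) →
    (p ++ q) ++ (r ++ (s ++ (t ++ u))) ≡ (p ++ (q ++ (r ++ (s ++ t)))) ++ u
  regroup₂ p q r s t u = solve (++-monoid Dart)
  regroup₃ : (p q r s : Polygon) → p ++ (q ++ (r ++ s)) ≡ (p ++ (q ++ r)) ++ s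
  regroup₃ p q r s = solve (++-monoid Dart)
  regroup₄ : (p q r s : Polygon) → (p ++ (q ++ r)) ++ s ≡ (p ++ q) ++ (r ++ s)
  regroup₄ p q r s = solve (++-monoid Dart)

-- Corners and 0-cells

-- At every corner of the path p ∷ w ++ [ q ], the end of the first dart is
-- ∼-related to the origin of the second.
Turns : Rel Dart 0ℓ → Dart → Polygon → Dart → Set
Turns _∼_ p []      q = inv p ∼ q
Turns _∼_ p (d ∷ w) q = (inv p ∼ d) × Turns _∼_ d w q

module _ {_∼_ : Rel Dart 0ℓ} where

  turns-∈ : ∀ {p q x y} w → Turns _∼_ p w q → (x , y) ∈ zip (p ∷ w) (w ++ [ q ]) → inv x ∼ y
  turns-∈ []      p∼q       (here refl) = p∼q
  turns-∈ (d ∷ w) (p∼d , _) (here refl) = p∼d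
  turns-∈ (d ∷ w) (_ , ts)  (there xy∈) = turns-∈ w ts xy∈

  ∈-turns : ∀ {p q} w → (∀ {x y} → (x , y) ∈ zip (p ∷ w) (w ++ [ q ]) → inv x ∼ y) → Turns _∼_ p w q
  ∈-turns []      f = f (here refl)
  ∈-turns (d ∷ w) f = f (here refl) , ∈-turns w (λ xy∈ → f (there xy∈))

  turns-++⁻ : ∀ {p q t} u {v} → Turns _∼_ p (u ++ t ∷ v) q → Turns _∼_ p u t × Turns _∼_ t v q
  turns-++⁻ []      (p∼t , ts) = p∼t , ts
  turns-++⁻ (d ∷ u) (p∼d , ts) = let us , vs = turns-++⁻ u ts in (p∼d , us) , vs

  turns-++⁺ : ∀ {p q t} u {v} → Turns _∼_ p u t → Turns _∼_ t v q → Turns _∼_ p (u ++ t ∷ v) q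
  turns-++⁺ []      p∼t        vs = p∼t , vs
  turns-++⁺ (d ∷ u) (p∼d , us) vs = p∼d , turns-++⁺ u us vs

sameOrigin-turns : ∀ p w → Turns (SameOrigin [ p ∷ w ]) p w p
sameOrigin-turns p w = ∈-turns w λ {x} xy∈ →
  Eq.return (p ∷ w , here refl , subst (λ d → (d , _) ∈ corners (p ∷ w)) (sym (inv-involutive x)) xy∈)

-- The path from `p` back to `p` passes every corner of the polygon, and the corners generate
-- `SameOrigin`. The lemma serves both to separate vertices by an invariant and to carry
-- identifications from one polygon to another.
sameOrigin-least : ∀ {_∼_ : Rel Dart 0ℓ} p w → IsEquivalence _∼_ →
  Turns _∼_ p w p → SameOrigin [ p ∷ w ] ⇒ _∼_
sameOrigin-least {_∼_} p w ∼-equiv ts = Eq.fold ∼-equiv corner∼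
  where
  corner∼ : CornerIdentification [ p ∷ w ] ⇒ _∼_
  corner∼ {x} (_ , here refl , xy∈) = subst (_∼ _) (inv-involutive x) (turns-∈ w ts xy∈)

-- A new edge E from the corner before a to the corner before b, tied up with
-- a new loop F at the latter.
tied : ℕ → ℕ → Polygon → Dart → Polygon → Dart → Polygon → Polygon
tied E F A a D b B = A ++ E ⁺ ∷ F ⁺ ∷ E ⁻ ∷ a ∷ D ++ F ⁺ ∷ b ∷ B

module _ {_∼_ : Rel Dart 0ℓ} (∼-equiv : IsEquivalence _∼_) where
  private
    module ∼ = IsEquivalence ∼-equiv

  turns-respʳ : ∀ {p q r} w → q ∼ r → Turns _∼_ p w q → Turns _∼_ p w r
  turns-respʳ []      q∼r p∼q        = ∼.trans p∼q q∼r
  turns-respʳ (d ∷ w) q∼r (p∼d , ts) = p∼d , turns-respʳ w q∼r ts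

  -- The three corners around the insertion before `a` and the one between `F` and `b` put both ends
  -- of `F` and the end of `E` at `b`, and the origin of `E` at `a`. The old corners at `a` and `b`
  -- follow by transitivity through `E ⁺` and `F ⁺`.
  turns-tied⁻ : ∀ {E F A a D b B p q} → Turns _∼_ p (tied E F A a D b B) q →
    Turns _∼_ p (A ++ a ∷ D ++ b ∷ B) q × ((E ⁺) ∼ a) × ((E ⁻) ∼ b)
  turns-tied⁻ {A = A} {D = D} ts =
    let As , E⁻∼F⁺ , F⁻∼E⁻ , E⁺∼a , ts′ = turns-++⁻ A ts
        Ds , F⁻∼b , Bs                  = turns-++⁻ D ts′
        F⁺∼b = ∼.trans (∼.sym E⁻∼F⁺) (∼.trans (∼.sym F⁻∼E⁻) F⁻∼b)
    in turns-++⁺ A (turns-respʳ A E⁺∼a As) (turns-++⁺ D (turns-respʳ D F⁺∼b Ds) Bs)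
     , E⁺∼a , ∼.trans E⁻∼F⁺ F⁺∼b

  turns-tied⁺ : ∀ {E F A a D b B p q} → Turns _∼_ p (A ++ a ∷ D ++ b ∷ B) q →
    (E ⁺) ∼ a → (E ⁻) ∼ b → (F ⁺) ∼ b → (F ⁻) ∼ b → Turns _∼_ p (tied E F A a D b B) q
  turns-tied⁺ {A = A} {D = D} ts E⁺∼a E⁻∼b F⁺∼b F⁻∼b =
    let As , ts′ = turns-++⁻ A ts
        Ds , Bs  = turns-++⁻ D ts′
    in turns-++⁺ A (turns-respʳ A (∼.sym E⁺∼a) As)
         ( ∼.trans E⁻∼b (∼.sym F⁺∼b) , ∼.trans F⁻∼b (∼.sym E⁻∼b) , E⁺∼a
         , turns-++⁺ D (turns-respʳ D (∼.sym F⁺∼b) Ds) (F⁻∼b , Bs))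

-- Sends the darts of tied E F A a D b B to darts of A ++ a ∷ D ++ b ∷ B with
-- the same origin.
untie : ℕ → ℕ → Dart → Dart → Dart → Dart
untie E F a b d with label d ≟ E | label d ≟ F | d
... | yes _ | _     | _ ⁺ = a
... | yes _ | _     | _ ⁻ = b
... | no _  | yes _ | _   = b
... | no _  | no _  | _   = d

module _ {E F : ℕ} {a b : Dart} where

  untie-E⁺ : untie E F a b (E ⁺) ≡ a
  untie-E⁺ with E ≟ E
  ... | yes _  = refl
  ... | no E≢E = contradiction refl E≢E

  untie-E⁻ : untie E F a b (E ⁻) ≡ b
  untie-E⁻ with E ≟ E
  ... | yes _  = refl
  ... | no E≢E = contradiction refl E≢E

  untie-F : ∀ d → label d ≡ F → F ≢ E → untie E F a b d ≡ b
  untie-F d d≡F F≢E with label d ≟ E | label d ≟ F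
  ... | yes d≡E | _      = contradiction (trans (sym d≡F) d≡E) F≢E
  ... | no _    | yes _  = refl
  ... | no _    | no d≢F = contradiction d≡F d≢F

  untie-fresh : ∀ d → label d ≢ E → label d ≢ F → untie E F a b d ≡ d
  untie-fresh d d≢E d≢F with label d ≟ E | label d ≟ F
  ... | yes d≡E | _       = contradiction d≡E d≢E
  ... | no _    | yes d≡F = contradiction d≡F d≢F
  ... | no _    | no _    = refl

module _ {_∼_ : Rel Dart 0ℓ} (f : Dart → Dart) (P : Dart → Set)
         (P-inv : ∀ {d} → P d → P (inv d)) (f-id : ∀ {d} → P d → f d ≡ d) where

  -- A turn compares the inverse of one dart with the next dart, so `f` has to fix inverses as well;
  -- this is why `P` is closed under `inv`.
  turns-on : ∀ {p q} w → P p → All P w → P q → Turns _∼_ p w q → Turns (_∼_ on f) p w q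
  turns-on []      Pp []        Pq p∼q        = subst₂ _∼_ (sym (f-id (P-inv Pp))) (sym (f-id Pq)) p∼q
  turns-on (d ∷ w) Pp (Pd ∷ Pw) Pq (p∼d , ts) =
    subst₂ _∼_ (sym (f-id (P-inv Pp))) (sym (f-id Pd)) p∼d , turns-on w Pd Pw Pq ts

-- The embedding of the complete graphs

-- Cutting and pasting as above yields negatively oriented cross-caps.
crossCaps⁻ : ℕ → Polygon
crossCaps⁻ zero    = []
crossCaps⁻ (suc k) = suc k ⁻ ∷ suc k ⁻ ∷ crossCaps⁻ k

crossCaps⁻-labels : ∀ k → All (λ d → 0 < label d × label d ≤ k) (crossCaps⁻ k)
crossCaps⁻-labels zero    = []
crossCaps⁻-labels (suc k) = (s≤s z≤n , ≤-refl) ∷ (s≤s z≤n , ≤-refl) ∷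
  All.map (λ (0< , ≤k) → 0< , m≤n⇒m≤1+n ≤k) (crossCaps⁻-labels k)

crossCaps⁻-fresh : ∀ {n} k → k < n → FreshIn n (crossCaps⁻ k)
crossCaps⁻-fresh k k<n = All.map (λ (_ , ≤k) → <⇒≢ (≤-<-trans ≤k k<n)) (crossCaps⁻-labels k)

-- The 1-cell 0 keeps its orientation because the sphere model begins with `0 ⁺ ∷ 0 ⁻`.
reverseCaps : ℕ → Dart
reverseCaps zero    = zero ⁺
reverseCaps (suc n) = suc n ⁻

reverseCaps-injective : Injective _≡_ _≡_ (λ n → label (reverseCaps n))
reverseCaps-injective {zero}  {zero}  _  = refl
reverseCaps-injective {suc _} {suc _} eq = eq

map-reverseCaps : ∀ k → map (rename reverseCaps) (crossCaps⁻ k) ≡ crossCaps k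
map-reverseCaps zero    = refl
map-reverseCaps (suc k) = cong (λ w → suc k ⁺ ∷ suc k ⁺ ∷ w) (map-reverseCaps k)

-- The vertex i of the graph is the origin of node K i; the labels 1, …, K are
-- reserved for the cross-caps.
node : ℕ → ℕ → Dart
node K i = (suc (i + K)) ⁺

-- Walking around a path traverses it once forwards and once backwards, hence the nested word. Node
-- numbers decrease inwards, so a longer spine wraps a shorter one.
spine : ℕ → ℕ → Polygon
spine K zero    = []
spine K (suc m) = node K m ∷ spine K m ++ [ inv (node K m) ]

spine-labels : ∀ K m → All (λ d → K < label d × label d ≤ m + K) (spine K m)
spine-labels K zero    = []
spine-labels K (suc m) = new ∷ ++⁺ (All.map (λ (K< , ≤m+K) → K< , m≤n⇒m≤1+n ≤m+K) (spine-labels K m)) (new ∷ [])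
  where
  new : K < suc (m + K) × suc (m + K) ≤ suc (m + K)
  new = s≤s (m≤n+m K m) , ≤-refl

node∈spine : ∀ {K i m} → i < m → node K i ∈ spine K m
node∈spine {K} {i} {suc m} (s≤s i≤m) with m≤n⇒m<n∨m≡n i≤m
... | inj₁ i<m  = there (Sublist.lookup (Sublist.++⁺ʳ _ ⊆-refl) (node∈spine i<m))
... | inj₂ refl = here refl

-- Nodes with larger numbers lie further out in the nesting, so their forward darts come first. This
-- locates the two corners between which `attach` draws an edge.
nodes⊆spine : ∀ {K i j m} → i < j → j < m → node K j ∷ node K i ∷ [] ⊆ spine K m
nodes⊆spine {K} {i} {j} {suc m} i<j (s≤s j≤m) with m≤n⇒m<n∨m≡n j≤m
... | inj₁ j<m  = node K m ∷ʳ Sublist.++⁺ʳ _ (nodes⊆spine i<j j<m)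
... | inj₂ refl = refl ∷ Sublist.++⁺ʳ _ (from∈ (node∈spine i<j))

⊆-split : ∀ {A : Set} {x : A} {xs ys} → x ∷ xs ⊆ ys → ∃[ us ] ∃[ vs ] (ys ≡ us ++ x ∷ vs × xs ⊆ vs)
⊆-split (refl ∷ τ) = [] , _ , refl , τ
⊆-split (y ∷ʳ τ)   = let us , vs , eq , σ = ⊆-split τ in y ∷ us , vs , cong (y ∷_) eq , σ

unsubdivided : ∀ {a b} w → FreshIn a w → concatMap (subdivideDart a b) w ≡ w
unsubdivided []        []        = refl
unsubdivided {a} (n ⁺ ∷ w) (n≢a ∷ w#a) with n ≟ a
... | yes n≡a = contradiction n≡a n≢a
... | no _    = cong (n ⁺ ∷_) (unsubdivided w w#a)
unsubdivided {a} (n ⁻ ∷ w) (n≢a ∷ w#a) with n ≟ a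
... | yes n≡a = contradiction n≡a n≢a
... | no _    = cong (n ⁻ ∷_) (unsubdivided w w#a)

-- The two occurrences of the 1-cell 0 enclose the spine. Subdividing it puts `b ⁺` before the spine
-- and `b ⁻` behind it, which is the new outermost node; all other labels are nonzero and stay as
-- they are.
growSpine : ∀ {K} m → [ 0 ⁺ ∷ spine K m ++ 0 ⁻ ∷ crossCaps⁻ K ] ≅ [ 0 ⁺ ∷ spine K (suc m) ++ 0 ⁻ ∷ crossCaps⁻ K ]
growSpine {K} m = begin
  [ 0 ⁺ ∷ spine K m ++ 0 ⁻ ∷ crossCaps⁻ K ] ≈⟨ step (subdivide₁ 0 b (bFresh ∷ [])) ⟩
  [ 0 ⁺ ∷ b ⁺ ∷ concatMap (subdivideDart 0 b) (spine K m ++ 0 ⁻ ∷ crossCaps⁻ K) ]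
    ≡⟨ cong (λ w → [ 0 ⁺ ∷ b ⁺ ∷ w ]) subdivided ⟩
  [ 0 ⁺ ∷ b ⁺ ∷ spine K m ++ b ⁻ ∷ 0 ⁻ ∷ crossCaps⁻ K ]
    ≡⟨ cong (λ w → [ 0 ⁺ ∷ b ⁺ ∷ w ]) (++-assoc (spine K m) [ b ⁻ ] (0 ⁻ ∷ crossCaps⁻ K)) ⟨
  [ 0 ⁺ ∷ b ⁺ ∷ (spine K m ++ [ b ⁻ ]) ++ 0 ⁻ ∷ crossCaps⁻ K ] ∎
  where
  open ≅-Reasoning
  b = suc (m + K)
  bFresh : FreshIn b (0 ⁺ ∷ spine K m ++ 0 ⁻ ∷ crossCaps⁻ K)
  bFresh = (λ ()) ∷ ++⁺ (All.map (λ (_ , ≤m+K) → <⇒≢ (s≤s ≤m+K)) (spine-labels K m))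
    ((λ ()) ∷ crossCaps⁻-fresh K (s≤s (m≤n+m K m)))
  subdivided : concatMap (subdivideDart 0 b) (spine K m ++ 0 ⁻ ∷ crossCaps⁻ K) ≡
    spine K m ++ b ⁻ ∷ 0 ⁻ ∷ crossCaps⁻ K
  subdivided = trans (concatMap-++ (subdivideDart 0 b) (spine K m) (0 ⁻ ∷ crossCaps⁻ K))
    (cong₂ _++_
      (unsubdivided (spine K m) (All.map (λ (K< , _) → m<n⇒n≢0 K<) (spine-labels K m)))
      (cong (λ w → b ⁻ ∷ 0 ⁻ ∷ w)
        (unsubdivided (crossCaps⁻ K) (All.map (λ (0< , _) → m<n⇒n≢0 0<) (crossCaps⁻-labels K)))))

spine≅sphere : ∀ K m → [ 0 ⁺ ∷ spine K m ++ 0 ⁻ ∷ crossCaps⁻ K ] ≅ sphereWithCrossCaps K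
spine≅sphere K zero    = begin
  [ 0 ⁺ ∷ 0 ⁻ ∷ crossCaps⁻ K ]                           ≈⟨ step (relabel reverseCaps reverseCaps-injective) ⟩
  [ 0 ⁺ ∷ 0 ⁻ ∷ map (rename reverseCaps) (crossCaps⁻ K) ] ≡⟨ cong (λ w → [ 0 ⁺ ∷ 0 ⁻ ∷ w ]) (map-reverseCaps K) ⟩
  [ 0 ⁺ ∷ 0 ⁻ ∷ crossCaps K ]                            ∎
  where open ≅-Reasoning
spine≅sphere K (suc m) = ≅.trans (≅.sym (growSpine m)) (spine≅sphere K m)

-- In the spine, node K i runs from the point i + K + 1 to the point i + K.
originIndex : ℕ → ℕ → Dart → ℕ
originIndex K m (n ⁺)     = n
originIndex K m (zero ⁻)  = m + K
originIndex K m (suc n ⁻) = n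

-- `M` is the length of the whole spine and stays fixed while the induction descends to the inner
-- part of length `m`.
spine-turns : ∀ {K p q} M m → originIndex K M (inv p) ≡ m + K → originIndex K M q ≡ m + K →
  Turns (_≡_ on originIndex K M) p (spine K m) q
spine-turns M zero    p↦ q↦ = trans p↦ (sym q↦)
spine-turns M (suc m) p↦ q↦ = p↦ , turns-++⁺ (spine _ m) (spine-turns M m refl refl) (sym q↦)

-- The invariant after the edges in `L` have been drawn. Labels from `bound` on are available for
-- new edges, and `spine⊆` preserves the darts at which they attach. The field `genus` allows `k`
-- further cross-caps behind the walk, so that each new edge can hand two of its own to the previous
-- stage.
record Stage (K m : ℕ) (L : List (ℕ × ℕ)) : Set where
  field
    walk     : Polygon
    bound    : ℕ
    K<bound  : K < bound
    beyond   : ∀ {n} → bound ≤ n → FreshIn n walk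
    reserved : ∀ {n} → 0 < n → n ≤ K → FreshIn n walk
    spine⊆   : spine K m ⊆ walk
    genus    : ∀ k → length L * 2 + k ≤ K →
      [ 0 ⁺ ∷ walk ++ crossCaps⁻ k ] ≅ [ 0 ⁺ ∷ spine K m ++ 0 ⁻ ∷ crossCaps⁻ (length L * 2 + k) ]
    distinct : ∀ {i j} → i < m → j < m →
      SameOrigin [ 0 ⁺ ∷ walk ] (node K i) (node K j) → i ≡ j
    edges    : ∀ {i j} → (i , j) ∈ L → ∃[ d ] (d ∈ 0 ⁺ ∷ walk ×
      SameOrigin [ 0 ⁺ ∷ walk ] d (node K j) × SameOrigin [ 0 ⁺ ∷ walk ] (inv d) (node K i))

start : ∀ K m → Stage K m []
start K m = record
  { walk     = spine K m ++ [ 0 ⁻ ]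
  ; bound    = suc (m + K)
  ; K<bound  = s≤s (m≤n+m K m)
  ; beyond   = λ m+K<n → ++⁺ (All.map (λ (_ , ≤m+K) → <⇒≢ (≤-<-trans ≤m+K m+K<n)) (spine-labels K m))
                             (<⇒≢ (≤-<-trans z≤n m+K<n) ∷ [])
  ; reserved = λ 0<n n≤K → ++⁺ (All.map (λ (K< , _) → >⇒≢ (≤-<-trans n≤K K<)) (spine-labels K m)) (<⇒≢ 0<n ∷ [])
  ; spine⊆   = Sublist.++⁺ʳ _ ⊆-refl
  ; genus    = λ k _ → ≅.reflexive (cong (λ w → [ 0 ⁺ ∷ w ]) (++-assoc (spine K m) [ 0 ⁻ ] (crossCaps⁻ k)))
  -- `originIndex` is constant on 0-cells and takes the value `i + K + 1` at node `i`.
  ; distinct = λ {i} {j} _ _ i∼j → +-cancelʳ-≡ K i j (suc-injective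
      (sameOrigin-least (0 ⁺) (spine K m ++ [ 0 ⁻ ]) (On.isEquivalence (originIndex K m) isEquivalence)
        (turns-++⁺ (spine K m) (spine-turns m m refl refl) refl) i∼j))
  ; edges    = λ ()
  }

module _ {E F : ℕ} {A : Polygon} {a : Dart} {D : Polygon} {b : Dart} {B : Polygon} where

  ⊆-tied : A ++ a ∷ D ++ b ∷ B ⊆ tied E F A a D b B
  ⊆-tied = Sublist.++⁺ (⊆-refl {x = A}) (E ⁺ ∷ʳ F ⁺ ∷ʳ E ⁻ ∷ʳ refl ∷ Sublist.++⁺ (⊆-refl {x = D}) (F ⁺ ∷ʳ ⊆-refl))

  fresh-tied : ∀ {n} → E ≢ n → F ≢ n → FreshIn n (A ++ a ∷ D ++ b ∷ B) → FreshIn n (tied E F A a D b B)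
  fresh-tied E≢n F≢n w# =
    let A# , aDbB# = ++⁻ A w#
        D# , bB#   = ++⁻ D (All.tail aDbB#)
    in ++⁺ A# (E≢n ∷ F≢n ∷ E≢n ∷ All.head aDbB# ∷ ++⁺ D# (F≢n ∷ bB#))

  -- Here `X = k + 1` and `Y = k + 2`, so that the two new cross-caps continue the numbering of
  -- `crossCaps⁻ k`.
  tied-genus : ∀ {k} → F ≢ E → suc (suc k) < E → suc (suc k) < F →
    FreshIn E (A ++ a ∷ D ++ b ∷ B) → FreshIn F (A ++ a ∷ D ++ b ∷ B) →
    FreshIn (suc k) (A ++ a ∷ D ++ b ∷ B) → FreshIn (suc (suc k)) (A ++ a ∷ D ++ b ∷ B) →
    [ 0 ⁺ ∷ tied E F A a D b B ++ crossCaps⁻ k ] ≅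
    [ 0 ⁺ ∷ (A ++ a ∷ D ++ b ∷ B) ++ crossCaps⁻ (suc (suc k)) ]
  tied-genus {k} F≢E 2+k<E 2+k<F E# F# X# Y# = begin
    [ 0 ⁺ ∷ tied E F A a D b B ++ crossCaps⁻ k ]
      ≡⟨ cong (λ w → [ 0 ⁺ ∷ w ]) (regroup A (E ⁺ ∷ F ⁺ ∷ E ⁻ ∷ a ∷ D) (F ⁺ ∷ b ∷ B) (crossCaps⁻ k)) ⟩
    [ (0 ⁺ ∷ A) ++ E ⁺ ∷ F ⁺ ∷ E ⁻ ∷ (a ∷ D) ++ F ⁺ ∷ (b ∷ B) ++ crossCaps⁻ k ]
      ≈⟨ tieToCrosscaps (0 ⁺ ∷ A) (a ∷ D) (b ∷ B) (crossCaps⁻ k)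
           F≢E (<⇒≢ (m+n≤o⇒n≤o 1 2+k<E)) (<⇒≢ (m+n≤o⇒n≤o 1 2+k<F)) (<⇒≢ 2+k<E) (>⇒≢ (n<1+n _))
           (fresh (m+n≤o⇒n≤o 2 2+k<E) E#) (fresh (m+n≤o⇒n≤o 2 2+k<F) F#)
           (fresh (n<1+n _) X#) (fresh (m≤n⇒m≤1+n (n<1+n _)) Y#) ⟩
    [ (0 ⁺ ∷ A) ++ (a ∷ D) ++ (b ∷ B) ++ crossCaps⁻ (suc (suc k)) ]
      ≡⟨ cong (λ w → [ 0 ⁺ ∷ w ]) (regroup A (a ∷ D) (b ∷ B) (crossCaps⁻ (suc (suc k)))) ⟨
    [ 0 ⁺ ∷ (A ++ a ∷ D ++ b ∷ B) ++ crossCaps⁻ (suc (suc k)) ] ∎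
    where
    open ≅-Reasoning
    regroup : (p q r s : Polygon) → (p ++ (q ++ r)) ++ s ≡ p ++ (q ++ (r ++ s))
    regroup p q r s = solve (++-monoid Dart)
    fresh : ∀ {n} → k < n → FreshIn n (A ++ a ∷ D ++ b ∷ B) →
      FreshIn n ((0 ⁺ ∷ A) ++ (a ∷ D) ++ (b ∷ B) ++ crossCaps⁻ k)
    fresh k<n w# = subst (FreshIn _) (regroup (0 ⁺ ∷ A) (a ∷ D) (b ∷ B) (crossCaps⁻ k))
      (<⇒≢ (≤-<-trans z≤n k<n) ∷ ++⁺ w# (crossCaps⁻-fresh k k<n))

  -- The old `SameOrigin`, pulled back along `untie`, is an equivalence relation respecting every
  -- corner of the tied polygon, so it contains the new `SameOrigin`. Hence drawing an edge merges
  -- no old 0-cells.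
  tied-distinct : ∀ {x y} → F ≢ E → E ≢ 0 → F ≢ 0 →
    FreshIn E (A ++ a ∷ D ++ b ∷ B) → FreshIn F (A ++ a ∷ D ++ b ∷ B) →
    SameOrigin [ 0 ⁺ ∷ tied E F A a D b B ] x y →
    SameOrigin [ 0 ⁺ ∷ A ++ a ∷ D ++ b ∷ B ] (untie E F a b x) (untie E F a b y)
  tied-distinct F≢E E≢0 F≢0 E# F# =
    sameOrigin-least (0 ⁺) _ ∼-equiv (turns-tied⁺ ∼-equiv {A = A} {D = D}
      (turns-on {SameOrigin P} (untie E F a b) Old (λ {d} → Old-inv d) (λ (d≢E , d≢F) → untie-fresh _ d≢E d≢F)
        _ (0-old) old 0-old (sameOrigin-turns (0 ⁺) (A ++ a ∷ D ++ b ∷ B)))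
      (related (E ⁺) a (untie-E⁺ {E} {F}) (All.head aDbB-old))
      (related (E ⁻) b (untie-E⁻ {E} {F}) b-old)
      (related (F ⁺) b (untie-F (F ⁺) refl F≢E) b-old)
      (related (F ⁻) b (untie-F (F ⁻) refl F≢E) b-old))
    where
    P = [ 0 ⁺ ∷ A ++ a ∷ D ++ b ∷ B ]
    ∼-equiv : IsEquivalence (SameOrigin P on untie E F a b)
    ∼-equiv = On.isEquivalence (untie E F a b) (Eq.isEquivalence _)
    Old : Dart → Set
    Old d = label d ≢ E × label d ≢ F
    Old-inv : ∀ d → Old d → Old (inv d)
    Old-inv d = subst (λ n → n ≢ E × n ≢ F) (sym (label-inv d))
    0-old : Old (0 ⁺)
    0-old = (λ 0≡E → E≢0 (sym 0≡E)) , (λ 0≡F → F≢0 (sym 0≡F))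
    old : All Old (A ++ a ∷ D ++ b ∷ B)
    old = All.zip (E# , F#)
    aDbB-old : All Old (a ∷ D ++ b ∷ B)
    aDbB-old = ++⁻ʳ A old
    b-old : Old b
    b-old = All.head (++⁻ʳ D (All.tail aDbB-old))
    related : ∀ x y → untie E F a b x ≡ y → Old y → (SameOrigin P on untie E F a b) x y
    related x y x↦y (y≢E , y≢F) = subst (SameOrigin P (untie E F a b x))
      (trans x↦y (sym (untie-fresh y y≢E y≢F))) (Eq.reflexive _)

attach : ∀ {K m L i j} → i < j → j < m → Stage K m L → Stage K m ((i , j) ∷ L)
attach {K} {m} {L} {i} {j} i<j j<m record
  { walk = w ; bound = E ; K<bound = K<E ; beyond = beyond ; reserved = reserved
  ; spine⊆ = spine⊆ ; genus = genus ; distinct = distinct ; edges = edges }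
  with A , _ , refl , τ ← ⊆-split (⊆-trans (nodes⊆spine i<j j<m) spine⊆)
  with D , B , refl , _ ← ⊆-split τ = record
  { walk     = w′
  ; bound    = suc F
  ; K<bound  = m≤n⇒m≤1+n K<F
  ; beyond   = λ F<n → fresh-tied {A = A} {D = D} (<⇒≢ (<-trans (n<1+n E) F<n)) (<⇒≢ F<n)
                         (beyond (<⇒≤ (<-trans (n<1+n E) F<n)))
  ; reserved = λ 0<n n≤K → fresh-tied {A = A} {D = D} (>⇒≢ (≤-<-trans n≤K K<E)) (>⇒≢ (≤-<-trans n≤K K<F))
                             (reserved 0<n n≤K)
  ; spine⊆   = ⊆-trans spine⊆ (⊆-tied {A = A} {D = D})
  ; genus    = genus′
  ; distinct = λ i′<m j′<m i′∼j′ → distinct i′<m j′<m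
      (subst₂ (SameOrigin P) (untie-node i′<m) (untie-node j′<m)
        (tied-distinct {A = A} {D = D} F≢E (m<n⇒n≢0 K<E) (λ ()) E# F# i′∼j′))
  ; edges    = edges′
  }
  where
  F  = suc E
  P  = [ 0 ⁺ ∷ w ]
  w′ = tied E F A (node K j) D (node K i) B
  F≢E : F ≢ E
  F≢E = >⇒≢ (n<1+n E)
  K<F : K < F
  K<F = m≤n⇒m≤1+n K<E
  E# = beyond ≤-refl
  F# = beyond (n≤1+n E)
  untie-node : ∀ {l} → l < m → untie E F (node K j) (node K i) (node K l) ≡ node K l
  untie-node l<m = untie-fresh (node K _) (All.lookup E# l∈) (All.lookup F# l∈)
    where l∈ = Sublist.lookup spine⊆ (node∈spine l<m)
  genus′ : ∀ k → suc (suc (length L * 2 + k)) ≤ K →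
    [ 0 ⁺ ∷ w′ ++ crossCaps⁻ k ] ≅
    [ 0 ⁺ ∷ spine K m ++ 0 ⁻ ∷ crossCaps⁻ (suc (suc (length L * 2 + k))) ]
  genus′ k 2+l+k≤K = ≅.trans
    (tied-genus {A = A} {D = D} F≢E (≤-<-trans 2+k≤K K<E) (≤-<-trans 2+k≤K K<F) E# F#
      (reserved (s≤s z≤n) (<⇒≤ 2+k≤K)) (reserved (s≤s z≤n) 2+k≤K))
    -- The previous stage is used with `k + 2` trailing cross-caps, two of which replace the tie.
    (subst (λ n → [ 0 ⁺ ∷ w ++ crossCaps⁻ (suc (suc k)) ] ≅ [ 0 ⁺ ∷ spine K m ++ 0 ⁻ ∷ crossCaps⁻ n ]) shift
      (genus (suc (suc k)) (subst (_≤ K) (sym shift) 2+l+k≤K)))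
    where
    shift : length L * 2 + suc (suc k) ≡ suc (suc (length L * 2 + k))
    shift = trans (+-suc (length L * 2) (suc k)) (cong suc (+-suc (length L * 2) k))
    2+k≤K : suc (suc k) ≤ K
    2+k≤K = m+n≤o⇒n≤o (length L * 2) (subst (_≤ K) (sym shift) 2+l+k≤K)
  turns = turns-tied⁻ (Eq.isEquivalence _) {A = A} {D = D} (sameOrigin-turns (0 ⁺) w′)
  extend : ∀ {x y} → SameOrigin P x y → SameOrigin [ 0 ⁺ ∷ w′ ] x y
  extend = sameOrigin-least (0 ⁺) _ (Eq.isEquivalence _) (proj₁ turns)
  edges′ : ∀ {i′ j′} → (i′ , j′) ∈ (i , j) ∷ L → ∃[ d ] (d ∈ 0 ⁺ ∷ w′ ×
    SameOrigin [ 0 ⁺ ∷ w′ ] d (node K j′) × SameOrigin [ 0 ⁺ ∷ w′ ] (inv d) (node K i′))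
  edges′ (here refl) = E ⁺ , there (∈-++⁺ʳ A (here refl)) , proj₂ turns
  edges′ (there ij∈) =
    let d , d∈ , d∼j , d⁻¹∼i = edges ij∈
    in d , Sublist.lookup (refl ∷ ⊆-tied {A = A} {D = D}) d∈ , extend d∼j , extend d⁻¹∼i

-- The edges of the complete graph and the genus count

pairs : ℕ → List (ℕ × ℕ)
pairs zero    = []
pairs (suc n) = map (_, n) (upTo n) ++ pairs n

pairs-ordered : ∀ n → All (λ (i , j) → i < j × j < n) (pairs n)
pairs-ordered zero    = []
pairs-ordered (suc n) = ++⁺ (All.map⁺ (All.map (λ i<n → i<n , n<1+n n) (all-upTo n)))
  (All.map (λ (i<j , j<n) → i<j , m≤n⇒m≤1+n j<n) (pairs-ordered n))

∈-pairs : ∀ {i j n} → i < j → j < n → (i , j) ∈ pairs n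
∈-pairs {n = suc n} i<j (s≤s j≤n) with m≤n⇒m<n∨m≡n j≤n
... | inj₁ j<n  = ∈-++⁺ʳ _ (∈-pairs i<j j<n)
... | inj₂ refl = ∈-++⁺ˡ (∈-map⁺ (_, n) (∈-upTo⁺ i<j))

-- Every edge costs two cross-caps, so this product is the Euler genus attained.
length-pairs : ∀ n → length (pairs (suc n)) * 2 ≡ suc n * n
length-pairs zero    = refl
length-pairs (suc n) = begin
  length (pairs (suc (suc n))) * 2
    ≡⟨ cong (_* 2) (length-++ (map (_, suc n) (upTo (suc n)))) ⟩
  (length (map (_, suc n) (upTo (suc n))) + length (pairs (suc n))) * 2
    ≡⟨ cong (λ l → (l + length (pairs (suc n))) * 2) (trans (length-map _ (upTo (suc n))) (length-upTo (suc n))) ⟩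
  (suc n + length (pairs (suc n))) * 2
    ≡⟨ *-distribʳ-+ 2 (suc n) (length (pairs (suc n))) ⟩
  suc n * 2 + length (pairs (suc n)) * 2
    ≡⟨ cong (suc n * 2 +_) (length-pairs n) ⟩
  suc n * 2 + suc n * n
    ≡⟨ *-distribˡ-+ (suc n) 2 n ⟨
  suc n * suc (suc n)
    ≡⟨ *-comm (suc n) (suc (suc n)) ⟩
  suc (suc n) * suc n ∎
  where open ≡-Reasoning

complete : ℕ → Graph
complete n = record
  { order  = n
  ; Adj    = _≢_
  ; adj?   = λ u v → ¬? (u Fin.≟ v)
  ; sym    = ≢-sym
  ; irrefl = λ u≡v u≢v → u≢v u≡v
  }

stages : ∀ {K m} L → All (λ (i , j) → i < j × j < m) L → Stage K m L
stages []      []                    = start _ _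
stages (_ ∷ L) ((i<j , j<m) ∷ rest) = attach i<j j<m (stages L rest)

complete-embeddable : ∀ n → .{{NonZero (suc n * n)}} → EmbeddableOnEulerGenus (complete (suc n)) (suc n * n)
complete-embeddable n = P , nonOrientable K P≅ , record
  { at       = λ v → node K (toℕ v)
  ; occurs   = λ v → occurs (there (Sublist.lookup spine⊆ (node∈spine (toℕ<n v))))
  ; distinct = λ {u} {v} u∼v → toℕ-injective (distinct (toℕ<n u) (toℕ<n v) u∼v)
  ; edge     = edge
  }
  where
  K = suc n * n
  open Stage (stages {K} {suc n} (pairs (suc n)) (pairs-ordered (suc n)))
  P = [ 0 ⁺ ∷ walk ]
  genus≡K : length (pairs (suc n)) * 2 + 0 ≡ K
  genus≡K = trans (+-identityʳ _) (length-pairs n)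
  P≅ : P ≅ sphereWithCrossCaps K
  P≅ = ≅.trans
    (subst₂ (λ w k → [ 0 ⁺ ∷ w ] ≅ [ 0 ⁺ ∷ spine K (suc n) ++ 0 ⁻ ∷ crossCaps⁻ k ])
      (++-identityʳ walk) genus≡K (genus 0 (≤-reflexive genus≡K)))
    (spine≅sphere K (suc n))
  occurs : ∀ {d} → d ∈ 0 ⁺ ∷ walk → Occurs d P
  occurs d∈ = ∈-map⁺ label (∈-++⁺ˡ d∈)
  edge : ∀ {u v : Fin (suc n)} → u ≢ v → ∃[ d ] (Occurs d P ×
    SameOrigin P d (node K (toℕ u)) × SameOrigin P (inv d) (node K (toℕ v)))
  edge {u} {v} u≢v with <-cmp (toℕ u) (toℕ v)
  ... | tri≈ _ u≡v _ = contradiction (toℕ-injective u≡v) u≢v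
  ... | tri> _ _ v<u =
    let d , d∈ , d∼u , d⁻¹∼v = edges (∈-pairs v<u (toℕ<n u))
    in d , occurs d∈ , d∼u , d⁻¹∼v
  -- A stored edge leads from the larger to the smaller vertex, so here its dart has to be reversed.
  ... | tri< u<v _ _ =
    let d , d∈ , d∼v , d⁻¹∼u = edges (∈-pairs u<v (toℕ<n v))
    in inv d , subst (_∈ map label (concat P)) (sym (label-inv d)) (occurs d∈)
       , d⁻¹∼u , subst (λ e → SameOrigin P e (node K (toℕ v))) (sym (inv-involutive d)) d∼v

-- Defective colourings

module _ {n k : ℕ} (f : Fin n → Fin k) where

  class : Fin k → List (Fin n) → List (Fin n)
  class c = filter (λ u → f u Fin.≟ c)

  -- For the list of all vertices this is `sameColourNeighbours` in the complete graph; an arbitrary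
  -- list makes induction possible.
  classmates : Fin n → List (Fin n) → List (Fin n)
  classmates v = filter (λ u → ¬? (v Fin.≟ u) ×-dec (f u Fin.≟ f v))

  class≤classmates : ∀ v xs → All (v ≢_) xs → length (class (f v) xs) ≤ length (classmates v xs)
  class≤classmates v []       []           = z≤n
  class≤classmates v (x ∷ xs) (v≢x ∷ v∉xs) with ih ← class≤classmates v xs v∉xs | v Fin.≟ x | f x Fin.≟ f v
  ... | yes v≡x | _     = contradiction v≡x v≢x
  ... | no _    | yes _ = s≤s ih
  ... | no _    | no _  = ih

  -- The two filters differ only at `v`, which a duplicate-free list contains at most once; behind
  -- that occurrence `class≤classmates` takes over.
  class≤1+classmates : ∀ v xs → Unique xs → length (class (f v) xs) ≤ suc (length (classmates v xs))
  class≤1+classmates v []       []            = z≤n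
  class≤1+classmates v (x ∷ xs) (x∉xs ∷ uniq) with ih ← class≤1+classmates v xs uniq | v Fin.≟ x | f x Fin.≟ f v
  ... | yes refl | yes _ = s≤s (class≤classmates v xs x∉xs)
  ... | yes refl | no _  = ih
  ... | no _     | yes _ = s≤s ih
  ... | no _     | no _  = ih

-- In a nonempty class, pick a vertex `v`: all the others are neighbours of `v` with its colour, and
-- the defect bounds their number.
class-size : ∀ {n k} (d : Vec ℕ k) ((f , _) : DefectiveColouring (complete n) d) c →
  length (class f c (allFin n)) ≤ suc (lookup d c)
class-size {n} d (f , bounded) c with class f c (allFin n) in eq
... | []    = z≤n
... | v ∷ _ with _ , refl ← ∈-filter⁻ (λ u → f u Fin.≟ c) {xs = allFin n} (subst (v ∈_) (sym eq) (here refl)) =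
  ≤-trans (≤-reflexive (cong length (sym eq)))
    (≤-trans (class≤1+classmates f v (allFin n) (allFin⁺ n)) (s≤s (bounded v)))

length-classes : ∀ {n} (f : Fin n → Fin 3) xs → length xs ≡
  length (class f zero xs) + (length (class f (suc zero) xs) + length (class f (suc (suc zero)) xs))
length-classes f []       = refl
length-classes f (x ∷ xs) with ih ← length-classes f xs | f x
... | zero           = cong suc ih
... | suc zero       = trans (cong suc ih) (sym (+-suc (size zero) _))
  where size = λ c → length (class f c xs)
... | suc (suc zero) = trans (cong suc ih)
  (trans (sym (+-suc (size zero) _)) (cong (size zero +_) (sym (+-suc (size (suc zero)) _))))
  where size = λ c → length (class f c xs)

colourable⇒order≤ : ∀ {n m} → DefectiveColouring (complete n) (2 ∷ m ∷ m ∷ []) → n ≤ 3 + (suc m + suc m)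
colourable⇒order≤ {n} {m} col@(f , _) = ≤-trans
  (≤-reflexive (trans (sym (length-tabulate {n = n} (λ u → u))) (length-classes f (allFin n))))
  (+-mono-≤ (size≤ zero) (+-mono-≤ (size≤ (suc zero)) (size≤ (suc (suc zero)))))
  where size≤ = class-size (2 ∷ m ∷ m ∷ []) col

-- The floor of the square root and the choice of parameters

¼ : ℚᵘ
¼ = mkℚᵘ (ℤ.+ 1) 3

-- The field 3 of `¼` is the denominator minus one, so the square of `¼` has denominator 16.
-- Cross-multiplying the unnormalised fractions leaves exactly the two hypotheses.
floor-¼√ : ∀ {m g} → m * m * 16 ≤ g → g < suc m * suc m * 16 → m IsFloorOf ¼ √ g
floor-¼√ {m} {g} m²≤ <m² = *≤* (subst₂ ℤ._≤_ (square m) scaled (ℤ.+≤+ m²≤))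
                          , *<* (subst₂ ℤ._<_ scaled (square (suc m)) (ℤ.+<+ <m²))
  where
  square : ∀ k → ℤ.+ (k * k * 16) ≡ ℤ.+ k ℤ.* ℤ.+ k ℤ.* ℤ.+ 16
  square k = trans (ℤ.pos-* (k * k) 16) (cong (ℤ._* ℤ.+ 16) (ℤ.pos-* k k))
  scaled : ℤ.+ g ≡ ℤ.+ 1 ℤ.* ℤ.+ g ℤ.* ℤ.+ 1
  scaled = sym (trans (ℤ.*-identityʳ _) (ℤ.*-identityˡ (ℤ.+ g)))

mainTheorem9 : ∃[ c ] (Positive c ×
    (∀ (N : ℕ) → ∃[ g ] (N < g ×
    ∃[ G ] (EmbeddableOnEulerGenus G g ×
    ∃[ m ] (m IsFloorOf c √ g ×
    ¬ DefectiveColouring G (2 ∷ m ∷ m ∷ []))))))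
mainTheorem9 = ¼ , _ , λ N →
  -- The graph has `4m + 2` vertices, so `g = 16m² + 12m + 2` lies between `16m²` and `16(m + 1)²`.
  -- Exceeding the colouring bound `2m + 5` takes `m ≥ 2`, whence the offset in `m = 2 + N`.
  let n = 9 + 4 * N
      m = 2 + N
  in suc n * n , N<g N , complete (suc n) , complete-embeddable n , m
   , floor-¼√ {m} (lower N) (upper N) , λ col → <⇒≱ (few N) (colourable⇒order≤ col)
  where
  -- In this and the next three inequalities the difference of the two sides is written out as a
  -- polynomial in `N` with natural coefficients.
  N<g : ∀ N → N < (10 + 4 * N) * (9 + 4 * N)
  N<g N = subst (N <_) (eq N) (m≤m+n (suc N) _)
    where
    eq : ∀ N → suc N + (89 + 75 * N + 16 * (N * N)) ≡ (10 + 4 * N) * (9 + 4 * N)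
    eq = solve-∀
  lower : ∀ N → (2 + N) * (2 + N) * 16 ≤ (10 + 4 * N) * (9 + 4 * N)
  lower N = subst ((2 + N) * (2 + N) * 16 ≤_) (eq N) (m≤m+n _ _)
    where
    eq : ∀ N → (2 + N) * (2 + N) * 16 + (26 + 12 * N) ≡ (10 + 4 * N) * (9 + 4 * N)
    eq = solve-∀
  upper : ∀ N → (10 + 4 * N) * (9 + 4 * N) < (3 + N) * (3 + N) * 16
  upper N = subst ((10 + 4 * N) * (9 + 4 * N) <_) (eq N) (m≤m+n (suc _) _)
    where
    eq : ∀ N → suc ((10 + 4 * N) * (9 + 4 * N)) + (53 + 20 * N) ≡ (3 + N) * (3 + N) * 16
    eq = solve-∀
  few : ∀ N → 3 + ((3 + N) + (3 + N)) < 10 + 4 * N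
  few N = subst (3 + ((3 + N) + (3 + N)) <_) (eq N) (m≤m+n (suc _) _)
    where
    eq : ∀ N → suc (3 + ((3 + N) + (3 + N))) + 2 * N ≡ 10 + 4 * N
    eq = solve-∀
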